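{- Let $p \geq 2$ be a fixed even integer. There is a function $g_p\colon \mathbb{N}\to\mathbb{R}$ with $g_p(n)=o(n^2)$ as $n\to\infty$ such that, for all sufficiently large $n$ and every oriented graph $D$ of order $n$, $$\mathrm{inv}^{=p}(D) \leq \frac{\mathrm{fas}(D)}{\lceil p/2\rceil \cdot \lfloor p/2\rfloor} + g_p(n).$$
   Context: For an oriented graph $D$ and $X\subseteq V(D)$, the inversion of $X$ reverses the orientation of every arc with both endpoints in $X$. A $(=p)$-inversion is the inversion of a set of exactly $p$ vertices. $\mathrm{inv}^{=p}(D)$ is the minimum number of $(=p)$-inversions whose successive application makes $D$ acyclic ($+\infty$ if impossible). $\mathrm{fas}(D)$ is the minimum size of a set of arcs whose deletion makes $D$ acyclic. -}

module Defs where

open import Data.Nat as ℕ using (ℕ; zero; suc; _≤_)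
open import Data.Bool using (Bool; true; false; _∧_; not; if_then_else_; T)
open import Data.Fin using (Fin)
open import Data.Fin.Subset using (Subset; _∈_; ∣_∣)
open import Data.Fin.Subset.Properties using (_∈?_)
open import Data.List using (List; []; _∷_; allFin; map; foldl; length)
open import Data.Nat.ListAction using (sum)
open import Data.List.Relation.Unary.All using (All)
open import Data.Product using (Σ; ∃; _×_; _,_)
open import Data.Integer using (+_)
open import Data.Rational as ℚ using (ℚ; 0ℚ; _/_)
open import Relation.Binary.Construct.Closure.Transitive using (TransClosure)
open import Relation.Nullary using (¬_; does)
open import Relation.Binary.PropositionalEquality using (_≡_)

Digraph : ℕ → Set
Digraph n = Fin n → Fin n → Bool

IsOriented : ∀ {n} → Digraph n → Set
IsOriented {n} D = (∀ u → ¬ T (D u u)) × (∀ u v → T (D u v) → ¬ T (D v u))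

Arc : ∀ {n} → Digraph n → Fin n → Fin n → Set
Arc D u v = T (D u v)

Acyclic : ∀ {n} → Digraph n → Set
Acyclic {n} D = ∀ (v : Fin n) → ¬ TransClosure (Arc D) v v

invert : ∀ {n} → Subset n → Digraph n → Digraph n
invert X D u v = if does (u ∈? X) ∧ does (v ∈? X) then D v u else D u v

invertAll : ∀ {n} → List (Subset n) → Digraph n → Digraph n
invertAll Xs D = foldl (λ E X → invert X E) D Xs

ArcSet : ℕ → Set
ArcSet n = Fin n → Fin n → Bool

delete : ∀ {n} → ArcSet n → Digraph n → Digraph n
delete F D u v = D u v ∧ not (F u v)

size : ∀ {n} → ArcSet n → ℕ
size {n} F = sum (map (λ u → sum (map (λ v → if F u v then 1 else 0) (allFin n))) (allFin n))

IsFeedbackArcSet : ∀ {n} → Digraph n → ArcSet n → Set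
IsFeedbackArcSet D F = (∀ u v → T (F u v) → T (D u v)) × Acyclic (delete F D)

IsFas : ∀ {n} → Digraph n → ℕ → Set
IsFas D m = (∃ λ F → IsFeedbackArcSet D F × size F ≡ m)
          × (∀ F → IsFeedbackArcSet D F → m ≤ size F)

-- inv^{=p}(D) ≤ x  (x rational): some sequence of k (=p)-inversions, k ≤ x, makes D acyclic
InvEqLe : ∀ {n} → ℕ → Digraph n → ℚ → Set
InvEqLe {n} p D x = ∃ λ (Xs : List (Subset n)) →
  All (λ X → ∣ X ∣ ≡ p) Xs × Acyclic (invertAll Xs D) × ((+ length Xs / 1) ℚ.≤ x)

-- m / q as a rational (q = 0 never used; returns 0 then)
divℕ : ℕ → ℕ → ℚ
divℕ m zero = 0ℚ
divℕ m (suc k) = (+ m) / suc k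

LittleOSq : (ℕ → ℚ) → Set
LittleOSq g = ∀ (ε : ℚ) → 0ℚ ℚ.< ε → ∃ λ N → ∀ n → N ≤ n →
  ℚ.∣ g n ∣ ℚ.≤ ε ℚ.* (+ (n ℕ.* n) / 1)

{-# OPTIONS --safe #-}

-- Write p = 2h. Given disjoint A = A₁ ∪ A₂ and B = B₁ ∪ B₂ with parts of size h, the four inversions
-- of Aᵢ ∪ Bⱼ reverse exactly the 4h² pairs in A × B, since pairs inside a part are reversed twice.
-- Fix an ordering of the vertices with at most fas(D) backward arcs and greedily remove complete
-- bipartite K_{p,p}'s from the set of backward arcs, spending one inversion per h² arcs. By a weak
-- Kővári–Sós–Turán bound only O(n² / log n) backward arcs remain. For even p, any two pairs of
-- vertices can be reversed together, and nothing else, by at most 12 inversions; so each remaining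
-- arc is reversed together with the pair formed by the first two vertices of the ordering. Whether
-- that pair ends up reversed or not is irrelevant for acyclicity.
module Submission where

open import Defs
open import Data.Bool using (Bool; true; false; _∧_; _xor_; not; if_then_else_; T)
open import Data.Bool.Properties using (T?; T-≡; T-∧; xor-assoc; xor-same; xor-identityʳ; if-eta)
import Data.Bool.Solver
open import Data.Nat using (ℕ; zero; suc; NonZero; ⌈_/2⌉; ⌊_/2⌋; _+_; _*_; _∸_; _^_; _≤_; _<_; z≤n; s≤s)
open import Data.Nat.Properties
open import Data.Nat.Divisibility using (_∣_; divides)
open import Data.Nat.DivMod using (_/_; _%_; m≡m%n+[m/n]*n; m%n≤n; m/n*n≤m; [m+kn]%n≡m%n; m<n⇒m%n≡m)
open import Data.Nat.ListAction using (sum)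
open import Data.Nat.Tactic.RingSolver using (solve-∀)
open import Data.Integer as ℤ using () renaming (+_ to pos)
import Data.Integer.Properties as ℤ
open import Data.Rational as ℚ using (ℚ; mkℚ)
import Data.Rational.Properties as ℚ
open import Data.Rational.Unnormalised as ℚᵘ using (mkℚᵘ)
import Data.Rational.Unnormalised.Properties as ℚᵘ
open import Data.Fin as Fin using (Fin; zero; suc; toℕ)
import Data.Fin.Properties as Fin
open import Data.Fin.Induction using (spo-wellFounded)
open import Data.Fin.Subset using (Subset; ∣_∣)
open import Data.Fin.Subset.Properties using (_∈?_)
import Data.Vec as Vec
import Data.Vec.Properties as Vec
open import Data.List using (List; []; _∷_; _++_; map; length; allFin; filter; take; drop)
open import Data.List.Properties using (map-tabulate; length-map; length-take; length-drop; length-++; length-tabulate; take++drop≡id; filter-all)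
open import Data.List.Membership.Propositional using (_∈_; _∉_)
open import Data.List.Membership.Propositional.Properties using (∈-++⁺ˡ; ∈-++⁺ʳ; ∈-++⁻; ∈-filter⁺; ∈-filter⁻; ∈-allFin)
open import Data.List.Relation.Unary.Any using (here; there)
open import Data.List.Relation.Unary.All as All using (All; []; _∷_)
import Data.List.Relation.Unary.All.Properties as All
open import Data.List.Relation.Unary.AllPairs using ([]; _∷_)
open import Data.List.Relation.Unary.Unique.Propositional using (Unique)
import Data.List.Relation.Unary.Unique.Propositional.Properties as Unique
open import Data.Product using (Σ; ∃; _×_; _,_; proj₁; proj₂)
open import Data.Sum using (_⊎_; inj₁; inj₂)
open import Data.Empty using (⊥-elim)
open import Function using (_∘_; id; Equivalence)
open import Induction.WellFounded using (Acc; acc; WellFounded)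
open import Relation.Nullary using (¬_; Dec; yes; no; does; contradiction; ¬?)
open import Relation.Nullary.Decidable using (dec-true; dec-false)
open import Relation.Binary.Construct.Closure.Transitive as Plus using (TransClosure; [_]; _∷_)
open import Relation.Binary.Definitions using (tri<; tri≈; tri>)
open import Relation.Binary.PropositionalEquality

private variable
  A : Set
  n : ℕ

-- Finite sums

∑ : List A → (A → ℕ) → ℕ
∑ xs f = sum (map f xs)

bit : Bool → ℕ
bit b = if b then 1 else 0

∑-cong : (xs : List A) {f g : A → ℕ} → (∀ x → f x ≡ g x) → ∑ xs f ≡ ∑ xs g
∑-cong []       f≗g = refl
∑-cong (x ∷ xs) f≗g = cong₂ _+_ (f≗g x) (∑-cong xs f≗g)

∑-mono-≤ : (xs : List A) {f g : A → ℕ} → (∀ x → f x ≤ g x) → ∑ xs f ≤ ∑ xs g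
∑-mono-≤ []       f≤g = z≤n
∑-mono-≤ (x ∷ xs) f≤g = +-mono-≤ (f≤g x) (∑-mono-≤ xs f≤g)

∑-+ : (xs : List A) (f g : A → ℕ) → ∑ xs (λ x → f x + g x) ≡ ∑ xs f + ∑ xs g
∑-+ []       f g = refl
∑-+ (x ∷ xs) f g = trans (cong ((f x + g x) +_) (∑-+ xs f g))
                         (interchange (f x) (g x) (∑ xs f) (∑ xs g))
  where
  interchange : ∀ a b c d → (a + b) + (c + d) ≡ (a + c) + (b + d)
  interchange = solve-∀

∑-*ʳ : (xs : List A) (f : A → ℕ) (k : ℕ) → ∑ xs (λ x → f x * k) ≡ ∑ xs f * k
∑-*ʳ []       f k = refl
∑-*ʳ (x ∷ xs) f k = trans (cong (f x * k +_) (∑-*ʳ xs f k)) (sym (*-distribʳ-+ k (f x) (∑ xs f)))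

∑-*ˡ : (xs : List A) (k : ℕ) (f : A → ℕ) → ∑ xs (λ x → k * f x) ≡ k * ∑ xs f
∑-*ˡ xs k f = trans (∑-cong xs (λ x → *-comm k (f x))) (trans (∑-*ʳ xs f k) (*-comm (∑ xs f) k))

∑-∈ : {xs : List A} {x : A} (f : A → ℕ) → x ∈ xs → f x ≤ ∑ xs f
∑-∈ {xs = y ∷ xs} f (here refl) = m≤m+n (f y) (∑ xs f)
∑-∈ {xs = y ∷ xs} f (there x∈)  = ≤-trans (∑-∈ f x∈) (m≤n+m (∑ xs f) (f y))

∑-allFin-suc : (f : Fin (suc n) → ℕ) → ∑ (allFin (suc n)) f ≡ f zero + ∑ (allFin n) (f ∘ suc)
∑-allFin-suc f = cong (λ l → f zero + sum l)
  (trans (map-tabulate suc f) (sym (map-tabulate id (f ∘ suc))))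

∑-zero : (xs : List A) → ∑ xs (λ _ → 0) ≡ 0
∑-zero []       = refl
∑-zero (_ ∷ xs) = ∑-zero xs

∑-δ : (x : Fin n) → ∑ (allFin n) (λ u → bit (does (x Fin.≟ u))) ≡ 1
∑-δ {suc n} zero = trans (∑-allFin-suc {n} (λ u → bit (does (zero Fin.≟ u)))) (cong suc (∑-zero (allFin n)))
∑-δ {suc n} (suc x) = trans (∑-allFin-suc {n} (λ u → bit (does (suc x Fin.≟ u)))) (∑-δ x)

-- Characteristic functions over 𝔽₂

-- χ counts multiplicities modulo 2, which makes it additive in the list.
χ : List (Fin n) → Fin n → Bool
χ []       u = false
χ (x ∷ xs) u = does (x Fin.≟ u) xor χ xs u

χ-++ : (xs ys : List (Fin n)) (u : Fin n) → χ (xs ++ ys) u ≡ χ xs u xor χ ys u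
χ-++ []       ys u = refl
χ-++ (x ∷ xs) ys u = trans (cong (does (x Fin.≟ u) xor_) (χ-++ xs ys u))
                           (sym (xor-assoc (does (x Fin.≟ u)) (χ xs u) (χ ys u)))

χ⇒∈ : (xs : List (Fin n)) {u : Fin n} → T (χ xs u) → u ∈ xs
χ⇒∈ (x ∷ xs) {u} t with x Fin.≟ u
... | yes x≡u = here (sym x≡u)
... | no  _   = there (χ⇒∈ xs t)

∉⇒χ≡false : (xs : List (Fin n)) {u : Fin n} → u ∉ xs → χ xs u ≡ false
∉⇒χ≡false xs {u} u∉ with χ xs u in eq
... | false = refl
... | true  = contradiction (χ⇒∈ xs (Equivalence.from T-≡ eq)) u∉

-- Without repetitions the xor in `χ` never cancels, so it counts like addition.
∑-χ : {xs : List (Fin n)} → Unique xs → ∑ (allFin n) (bit ∘ χ xs) ≡ length xs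
∑-χ {n} {[]} [] = ∑-zero (allFin n)
∑-χ {n} {x ∷ xs} (x∉ ∷ uniq) = begin
  ∑ (allFin n) (bit ∘ χ (x ∷ xs))                                              ≡⟨ ∑-cong (allFin n) split ⟩
  ∑ (allFin n) (λ u → bit (does (x Fin.≟ u)) + bit (χ xs u))                   ≡⟨ ∑-+ (allFin n) (λ u → bit (does (x Fin.≟ u))) (bit ∘ χ xs) ⟩
  ∑ (allFin n) (λ u → bit (does (x Fin.≟ u))) + ∑ (allFin n) (bit ∘ χ xs)     ≡⟨ cong₂ _+_ (∑-δ x) (∑-χ uniq) ⟩
  suc (length xs)                                                              ∎
  where
  open ≡-Reasoning
  split : ∀ u → bit (χ (x ∷ xs) u) ≡ bit (does (x Fin.≟ u)) + bit (χ xs u)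
  split u with x Fin.≟ u
  ... | no  _    = refl
  ... | yes refl rewrite ∉⇒χ≡false xs {x} (λ x∈ → All.lookup x∉ x∈ refl) = refl

⟪_⟫ : List (Fin n) → Subset n
⟪ xs ⟫ = Vec.tabulate (χ xs)

∣tabulate∣ : (f : Fin n → Bool) → ∣ Vec.tabulate f ∣ ≡ ∑ (allFin n) (bit ∘ f)
∣tabulate∣ {zero}  f = refl
∣tabulate∣ {suc n} f = begin
  ∣ f zero Vec.∷ Vec.tabulate (f ∘ suc) ∣              ≡⟨ ∣∷∣ (f zero) (Vec.tabulate (f ∘ suc)) ⟩
  bit (f zero) + ∣ Vec.tabulate (f ∘ suc) ∣            ≡⟨ cong (bit (f zero) +_) (∣tabulate∣ (f ∘ suc)) ⟩
  bit (f zero) + ∑ (allFin n) (bit ∘ f ∘ suc)          ≡⟨ ∑-allFin-suc (bit ∘ f) ⟨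
  ∑ (allFin (suc n)) (bit ∘ f)                         ∎
  where
  open ≡-Reasoning
  ∣∷∣ : ∀ b (X : Subset n) → ∣ b Vec.∷ X ∣ ≡ bit b + ∣ X ∣
  ∣∷∣ true  X = refl
  ∣∷∣ false X = refl

∣⟪⟫∣ : {xs : List (Fin n)} → Unique xs → ∣ ⟪ xs ⟫ ∣ ≡ length xs
∣⟪⟫∣ {xs = xs} uniq = trans (∣tabulate∣ (χ xs)) (∑-χ uniq)

does-∈? : (u : Fin n) (X : Subset n) → does (u ∈? X) ≡ Vec.lookup X u
does-∈? zero    (true  Vec.∷ X) = refl
does-∈? zero    (false Vec.∷ X) = refl
does-∈? (suc u) (_     Vec.∷ X) = does-∈? u X

∈?⟪⟫ : (u : Fin n) (xs : List (Fin n)) → does (u ∈? ⟪ xs ⟫) ≡ χ xs u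
∈?⟪⟫ u xs = trans (does-∈? u ⟪ xs ⟫) (Vec.lookup∘tabulate (χ xs) u)

-- Parity of the number of inversions that reverse a given pair

κ : List (Fin n) → Fin n → Fin n → Bool
κ xs u v = χ xs u ∧ χ xs v

parity : List (List (Fin n)) → Fin n → Fin n → Bool
parity []         u v = false
parity (xs ∷ xss) u v = κ xs u v xor parity xss u v

parity-++ : (xss yss : List (List (Fin n))) (u v : Fin n) →
            parity (xss ++ yss) u v ≡ parity xss u v xor parity yss u v
parity-++ []         yss u v = refl
parity-++ (xs ∷ xss) yss u v = trans (cong (κ xs u v xor_) (parity-++ xss yss u v))
                                     (sym (xor-assoc (κ xs u v) (parity xss u v) (parity yss u v)))

-- Each inversion treats (u , v) and (v , u) alike and two reversals of a pair cancel, so neither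
-- the order of the inversions nor anything beyond the parity matters.
invertAll-parity : (xss : List (List (Fin n))) (D : Digraph n) (u v : Fin n) →
  invertAll (map ⟪_⟫ xss) D u v ≡ (if parity xss u v then D v u else D u v)
invertAll-parity []         D u v = refl
invertAll-parity (xs ∷ xss) D u v
  rewrite invertAll-parity xss (invert ⟪ xs ⟫ D) u v
        | ∈?⟪⟫ u xs | ∈?⟪⟫ v xs
  with χ xs u | χ xs v | parity xss u v
... | false | false | false = refl
... | false | false | true  = refl
... | false | true  | false = refl
... | false | true  | true  = refl
... | true  | false | false = refl
... | true  | false | true  = refl
... | true  | true  | false = refl
... | true  | true  | true  = refl

-- Pair functions produced by few inversions of p-sets

-- The Boolean function `f` is viewed over 𝔽₂, where concatenating sequences of inversions becomes
-- addition. The equation includes u = v, so that every realisation is a plain polynomial identity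
-- in characteristic functions.
Realised : ℕ → ℕ → (Fin n → Fin n → Bool) → Set
Realised {n} p k f = Σ (List (List (Fin n))) λ xss →
  All (λ xs → Unique xs × length xs ≡ p) xss × length xss ≤ k × (∀ u v → parity xss u v ≡ f u v)

realised-xor : ∀ {p k l} {f g : Fin n → Fin n → Bool} → Realised p k f → Realised p l g →
               Realised p (k + l) (λ u v → f u v xor g u v)
realised-xor (xss , pxss , xss≤ , xss≗) (yss , pyss , yss≤ , yss≗) =
  xss ++ yss , All.++⁺ pxss pyss ,
  ≤-trans (≤-reflexive (length-++ xss)) (+-mono-≤ xss≤ yss≤) ,
  λ u v → trans (parity-++ xss yss u v) (cong₂ _xor_ (xss≗ u v) (yss≗ u v))

realised-cong : ∀ {p k} {f g : Fin n → Fin n → Bool} → (∀ u v → f u v ≡ g u v) →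
                Realised p k f → Realised p k g
realised-cong f≗g (xss , pxss , xss≤ , xss≗) = xss , pxss , xss≤ , λ u v → trans (xss≗ u v) (f≗g u v)

-- Expanding the four products over 𝔽₂, each term inside one part occurs twice and vanishes. `B₁`
-- and `B₂` may overlap: `χ (B₁ ++ B₂)` is then their symmetric difference, which `realised-path`
-- exploits.
realised-biclique : ∀ {p} (A₁ A₂ B₁ B₂ : List (Fin n)) →
  All (λ xs → Unique xs × length xs ≡ p) ((A₁ ++ B₁) ∷ (A₁ ++ B₂) ∷ (A₂ ++ B₁) ∷ (A₂ ++ B₂) ∷ []) →
  Realised p 4 (λ u v → (χ (A₁ ++ A₂) u ∧ χ (B₁ ++ B₂) v) xor (χ (A₁ ++ A₂) v ∧ χ (B₁ ++ B₂) u))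
realised-biclique A₁ A₂ B₁ B₂ psets = _ , psets , ≤-refl , eq
  where
  open Data.Bool.Solver.xor-∧-Solver
  eq : ∀ u v → parity ((A₁ ++ B₁) ∷ (A₁ ++ B₂) ∷ (A₂ ++ B₁) ∷ (A₂ ++ B₂) ∷ []) u v ≡
               (χ (A₁ ++ A₂) u ∧ χ (B₁ ++ B₂) v) xor (χ (A₁ ++ A₂) v ∧ χ (B₁ ++ B₂) u)
  eq u v
    rewrite χ-++ A₁ B₁ u | χ-++ A₁ B₂ u | χ-++ A₂ B₁ u | χ-++ A₂ B₂ u | χ-++ A₁ A₂ u | χ-++ B₁ B₂ u
          | χ-++ A₁ B₁ v | χ-++ A₁ B₂ v | χ-++ A₂ B₁ v | χ-++ A₂ B₂ v | χ-++ A₁ A₂ v | χ-++ B₁ B₂ v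
    = solve 8 (λ a₁ a₂ b₁ b₂ a₁′ a₂′ b₁′ b₂′ →
        ((a₁ :+ b₁) :* (a₁′ :+ b₁′)) :+ (((a₁ :+ b₂) :* (a₁′ :+ b₂′)) :+
        (((a₂ :+ b₁) :* (a₂′ :+ b₁′)) :+ (((a₂ :+ b₂) :* (a₂′ :+ b₂′)) :+ con false)))
        := ((a₁ :+ a₂) :* (b₁′ :+ b₂′)) :+ ((a₁′ :+ a₂′) :* (b₁ :+ b₂)))
        refl (χ A₁ u) (χ A₂ u) (χ B₁ u) (χ B₂ u) (χ A₁ v) (χ A₂ v) (χ B₁ v) (χ B₂ v)

realised-≤ : ∀ {p k l} {f : Fin n → Fin n → Bool} → k ≤ l → Realised p k f → Realised p l f
realised-≤ k≤l (xss , pxss , xss≤ , xss≗) = xss , pxss , ≤-trans xss≤ k≤l , xss≗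

-- Reversing two pairs with the help of padding vertices

without : List (Fin n) → List (Fin n)
without []       = allFin _
without (a ∷ as) = filter (λ x → ¬? (a Fin.≟ x)) (without as)

without-unique : (as : List (Fin n)) → Unique (without as)
without-unique []       = Unique.allFin⁺ _
without-unique (a ∷ as) = Unique.filter⁺ (λ x → ¬? (a Fin.≟ x)) (without-unique as)

without-∉ : (as : List (Fin n)) {x : Fin n} → x ∈ without as → x ∉ as
without-∉ (a ∷ as) x∈ (here refl) = proj₂ (∈-filter⁻ (λ x → ¬? (a Fin.≟ x)) {xs = without as} x∈) refl
without-∉ (a ∷ as) x∈ (there x∈as) =
  without-∉ as (proj₁ (∈-filter⁻ (λ x → ¬? (a Fin.≟ x)) {xs = without as} x∈)) x∈as

length-filter-≢ : (a : Fin n) {xs : List (Fin n)} → Unique xs →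
                  length xs ≤ suc (length (filter (λ x → ¬? (a Fin.≟ x)) xs))
length-filter-≢ a {[]} [] = z≤n
length-filter-≢ a {x ∷ xs} (x∉ ∷ uniq) with a Fin.≟ x
... | no  _    = s≤s (length-filter-≢ a uniq)
... | yes refl = s≤s (≤-reflexive (sym (cong length (filter-all (λ x → ¬? (a Fin.≟ x)) x∉))))

length-without : (as : List (Fin n)) → n ≤ length as + length (without as)
length-without {n} []       = ≤-reflexive (sym (length-tabulate {n = n} id))
length-without     (a ∷ as) = ≤-trans (length-without as)
  (≤-trans (+-monoʳ-≤ (length as) (length-filter-≢ a (without-unique as)))
           (≤-reflexive (+-suc (length as) _)))

∈-take⁻ : ∀ k {xs : List A} {x : A} → x ∈ take k xs → x ∈ xs
∈-take⁻ k {xs} x∈ = subst (_ ∈_) (take++drop≡id k xs) (∈-++⁺ˡ x∈)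

length-take-≤ : ∀ {k} {xs : List A} → k ≤ length xs → length (take k xs) ≡ k
length-take-≤ {k = k} {xs} k≤ = trans (length-take k xs) (m≤n⇒m⊓n≡m k≤)

-- Supplies the padding that brings inversion sets to size exactly p.
fresh : (as : List (Fin n)) (k : ℕ) → length as + k ≤ n →
        ∃ λ zs → Unique zs × length zs ≡ k × (∀ {x} → x ∈ zs → x ∉ as)
fresh as k as+k≤n =
  take k (without as) , Unique.take⁺ k (without-unique as) ,
  length-take-≤ (+-cancelˡ-≤ (length as) _ _ (≤-trans as+k≤n (length-without as))) ,
  λ x∈ → without-∉ as (∈-take⁻ k x∈)

-- Inverting {a , b} ∪ X ∪ Y and {c , b} ∪ X ∪ Y reverses all pairs {a , c} × ({b} ∪ X ∪ Y); the four
-- remaining inversions form a biclique pattern that restores {a , c} × (X ∪ Y).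
realised-path : ∀ k {a b c : Fin n} → 3 + (k + (k + k)) ≤ n → a ≢ b → b ≢ c → a ≢ c →
  Realised (2 + (k + k)) 6 (λ u v → κ (a ∷ b ∷ []) u v xor κ (b ∷ c ∷ []) u v)
realised-path {n} k {a} {b} {c} 3k≤n a≢b b≢c a≢c
  with X , uX , refl , X∉ ← fresh (a ∷ b ∷ c ∷ []) k (≤-trans (+-monoʳ-≤ 3 (m≤m+n k (k + k))) 3k≤n)
  with Y , uY , lY , Y∉ ← fresh (a ∷ b ∷ c ∷ X) k (≤-trans (+-monoʳ-≤ 3 (+-monoʳ-≤ k (m≤m+n k k))) 3k≤n)
  with Z , uZ , lZ , Z∉ ← fresh (a ∷ b ∷ c ∷ X ++ Y) k
         (≤-trans (≤-reflexive (cong (3 +_) (trans (cong (_+ k) (trans (length-++ X) (cong (k +_) lY))) (+-assoc k k k)))) 3k≤n)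
  = realised-cong eq (realised-xor
      (_ , pset a≢b uXY lXY (∉XY a∈) (∉XY b∈) ∷ pset (b≢c ∘ sym) uXY lXY (∉XY c∈) (∉XY b∈) ∷ [] , ≤-refl , λ _ _ → refl)
      -- Both right-hand parts contain b and Z, which cancel modulo 2 and leave X ∪ Y. Evenness of p
      -- enters here: X, Y, Z all have size k, so any two of them fill the p - 2 places beside b and
      -- one of a, c.
      (realised-biclique (a ∷ []) (c ∷ []) (b ∷ X ++ Z) (b ∷ Y ++ Z)
        ( pset a≢b uXZ lXZ (∉XZ a∈) (∉XZ b∈)
        ∷ pset a≢b uYZ lYZ (∉YZ a∈) (∉YZ b∈)
        ∷ pset (b≢c ∘ sym) uXZ lXZ (∉XZ c∈) (∉XZ b∈)
        ∷ pset (b≢c ∘ sym) uYZ lYZ (∉YZ c∈) (∉YZ b∈) ∷ [])))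
  where
  a∈ : a ∈ a ∷ b ∷ c ∷ []
  a∈ = here refl
  b∈ : b ∈ a ∷ b ∷ c ∷ []
  b∈ = there (here refl)
  c∈ : c ∈ a ∷ b ∷ c ∷ []
  c∈ = there (there (here refl))
  uXY : Unique (X ++ Y)
  uXY = Unique.++⁺ uX uY λ (x∈X , x∈Y) → Y∉ x∈Y (there (there (there x∈X)))
  uXZ : Unique (X ++ Z)
  uXZ = Unique.++⁺ uX uZ λ (x∈X , x∈Z) → Z∉ x∈Z (there (there (there (∈-++⁺ˡ x∈X))))
  uYZ : Unique (Y ++ Z)
  uYZ = Unique.++⁺ uY uZ λ (x∈Y , x∈Z) → Z∉ x∈Z (there (there (there (∈-++⁺ʳ X x∈Y))))
  lXY : length (X ++ Y) ≡ k + k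
  lXY = trans (length-++ X) (cong (k +_) lY)
  lXZ : length (X ++ Z) ≡ k + k
  lXZ = trans (length-++ X) (cong (k +_) lZ)
  lYZ : length (Y ++ Z) ≡ k + k
  lYZ = trans (length-++ Y) (cong₂ _+_ lY lZ)
  X∌ : ∀ {x} → x ∈ a ∷ b ∷ c ∷ [] → x ∉ X
  X∌ x∈ x∈X = X∉ x∈X x∈
  Y∌ : ∀ {x} → x ∈ a ∷ b ∷ c ∷ [] → x ∉ Y
  Y∌ x∈ x∈Y = Y∉ x∈Y (∈-++⁺ˡ x∈)
  Z∌ : ∀ {x} → x ∈ a ∷ b ∷ c ∷ [] → x ∉ Z
  Z∌ x∈ x∈Z = Z∉ x∈Z (∈-++⁺ˡ x∈)
  ∉-++ : ∀ {x : Fin n} {V W : List (Fin n)} → x ∉ V → x ∉ W → x ∉ V ++ W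
  ∉-++ {V = V} x∉V x∉W x∈ with ∈-++⁻ V x∈
  ... | inj₁ x∈V = x∉V x∈V
  ... | inj₂ x∈W = x∉W x∈W
  ∉XY : ∀ {x} → x ∈ a ∷ b ∷ c ∷ [] → x ∉ X ++ Y
  ∉XY x∈ = ∉-++ (X∌ x∈) (Y∌ x∈)
  ∉XZ : ∀ {x} → x ∈ a ∷ b ∷ c ∷ [] → x ∉ X ++ Z
  ∉XZ x∈ = ∉-++ (X∌ x∈) (Z∌ x∈)
  ∉YZ : ∀ {x} → x ∈ a ∷ b ∷ c ∷ [] → x ∉ Y ++ Z
  ∉YZ x∈ = ∉-++ (Y∌ x∈) (Z∌ x∈)
  pset : ∀ {x} {V : List (Fin n)} → x ≢ b → Unique V → length V ≡ k + k → x ∉ V → b ∉ V →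
         Unique (x ∷ b ∷ V) × length (x ∷ b ∷ V) ≡ 2 + (k + k)
  pset x≢b uV lV x∉V b∉V =
    ((x≢b ∷ All.¬Any⇒All¬ _ x∉V) ∷ All.¬Any⇒All¬ _ b∉V ∷ uV) , cong (2 +_) lV
  open Data.Bool.Solver.xor-∧-Solver
  eq : ∀ u v → parity ((a ∷ b ∷ X ++ Y) ∷ (c ∷ b ∷ X ++ Y) ∷ []) u v xor
               ((χ (a ∷ c ∷ []) u ∧ χ ((b ∷ X ++ Z) ++ (b ∷ Y ++ Z)) v) xor
                (χ (a ∷ c ∷ []) v ∧ χ ((b ∷ X ++ Z) ++ (b ∷ Y ++ Z)) u)) ≡
               κ (a ∷ b ∷ []) u v xor κ (b ∷ c ∷ []) u v
  eq u v
    rewrite χ-++ (b ∷ X ++ Z) (b ∷ Y ++ Z) u | χ-++ X Y u | χ-++ X Z u | χ-++ Y Z u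
          | χ-++ (b ∷ X ++ Z) (b ∷ Y ++ Z) v | χ-++ X Y v | χ-++ X Z v | χ-++ Y Z v
    = solve 12 (λ a b c x y z a′ b′ c′ x′ y′ z′ →
        (((a :+ (b :+ (x :+ y))) :* (a′ :+ (b′ :+ (x′ :+ y′)))) :+
         (((c :+ (b :+ (x :+ y))) :* (c′ :+ (b′ :+ (x′ :+ y′)))) :+ con false)) :+
        (((a :+ (c :+ con false)) :* ((b′ :+ (x′ :+ z′)) :+ (b′ :+ (y′ :+ z′)))) :+
         ((a′ :+ (c′ :+ con false)) :* ((b :+ (x :+ z)) :+ (b :+ (y :+ z)))))
        := ((a :+ (b :+ con false)) :* (a′ :+ (b′ :+ con false))) :+
           ((b :+ (c :+ con false)) :* (b′ :+ (c′ :+ con false))))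
        refl (δ a u) (δ b u) (δ c u) (χ X u) (χ Y u) (χ Z u)
             (δ a v) (δ b v) (δ c v) (χ X v) (χ Y v) (χ Z v)
    where
    δ : Fin n → Fin n → Bool
    δ x y = does (x Fin.≟ y)

κ-comm : (a b : Fin n) (u v : Fin n) → κ (a ∷ b ∷ []) u v ≡ κ (b ∷ a ∷ []) u v
κ-comm a b u v = cong₂ _∧_ (swap u) (swap v)
  where
  open Data.Bool.Solver.xor-∧-Solver
  swap : ∀ w → χ (a ∷ b ∷ []) w ≡ χ (b ∷ a ∷ []) w
  swap w = solve 2 (λ x y → x :+ (y :+ con false) := y :+ (x :+ con false))
                 refl (does (a Fin.≟ w)) (does (b Fin.≟ w))

realised-adjacent : ∀ k {a b c : Fin n} → 3 + (k + (k + k)) ≤ n → a ≢ b → b ≢ c →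
  Realised (2 + (k + k)) 6 (λ u v → κ (a ∷ b ∷ []) u v xor κ (b ∷ c ∷ []) u v)
realised-adjacent k {a} {b} {c} 3k≤n a≢b b≢c with a Fin.≟ c
... | no  a≢c  = realised-path k 3k≤n a≢b b≢c a≢c
-- For a = c the two pairs coincide and cancel, so no inversion is made.
... | yes refl = [] , [] , z≤n , λ u v →
  sym (trans (cong (_xor κ (b ∷ a ∷ []) u v) (κ-comm a b u v)) (xor-same (κ (b ∷ a ∷ []) u v)))

-- The pair {b , c} serves as a link: ab + bc and bc + cd are realised with 6 inversions each, and
-- bc cancels in the sum. If b = c, the two pairs are already adjacent.
realised-edges : ∀ k {a b c d : Fin n} → 3 + (k + (k + k)) ≤ n → a ≢ b → c ≢ d →
  Realised (2 + (k + k)) 12 (λ u v → κ (a ∷ b ∷ []) u v xor κ (c ∷ d ∷ []) u v)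
realised-edges k {a} {b} {c} {d} 3k≤n a≢b c≢d with b Fin.≟ c
... | yes refl = realised-≤ (m≤m+n 6 6) (realised-adjacent k 3k≤n a≢b c≢d)
... | no  b≢c  = realised-cong
  (λ u v → solve 3 (λ x y z → (x :+ y) :+ (y :+ z) := x :+ z) refl
             (κ (a ∷ b ∷ []) u v) (κ (b ∷ c ∷ []) u v) (κ (c ∷ d ∷ []) u v))
  (realised-xor (realised-adjacent k 3k≤n a≢b b≢c) (realised-adjacent k 3k≤n b≢c c≢d))
  where open Data.Bool.Solver.xor-∧-Solver

-- Finding bicliques

record Biclique (F : ArcSet n) (p q : ℕ) : Set where
  field
    left right   : List (Fin n)
    left-unique  : Unique left
    right-unique : Unique right
    left-length  : length left ≡ p
    right-length : length right ≡ q
    complete     : ∀ {a b} → a ∈ left → b ∈ right → T (F a b)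

arcs : ArcSet n → List (Fin n) → List (Fin n) → ℕ
arcs F S B = ∑ S λ u → ∑ B λ v → bit (F u v)

∑-filter : (P : A → Bool) (xs : List A) (f : A → ℕ) →
  ∑ xs f ≡ ∑ (filter (T? ∘ P) xs) f + ∑ (filter (¬? ∘ T? ∘ P) xs) f
∑-filter P []       f = refl
∑-filter P (x ∷ xs) f with P x
... | true  = trans (cong (f x +_) (∑-filter P xs f)) (sym (+-assoc (f x) _ _))
... | false = trans (cong (f x +_) (∑-filter P xs f)) (swap (f x) (∑ (filter (T? ∘ P) xs) f) _)
  where
  swap : ∀ a b c → a + (b + c) ≡ b + (a + c)
  swap = solve-∀

length-filter : (P : A → Bool) (xs : List A) →
  length xs ≡ length (filter (T? ∘ P) xs) + length (filter (¬? ∘ T? ∘ P) xs)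
length-filter P []       = refl
length-filter P (x ∷ xs) with P x
... | true  = cong suc (length-filter P xs)
... | false = trans (cong suc (length-filter P xs)) (sym (+-suc _ _))

∑-bit : (P : A → Bool) (xs : List A) → ∑ xs (bit ∘ P) ≡ length (filter (T? ∘ P) xs)
∑-bit P []       = refl
∑-bit P (x ∷ xs) with P x
... | true  = cong suc (∑-bit P xs)
... | false = ∑-bit P xs

arcs-filter : (F : ArcSet n) (P : Fin n → Bool) (S B : List (Fin n)) →
  arcs F S B ≡ arcs F S (filter (T? ∘ P) B) + arcs F S (filter (¬? ∘ T? ∘ P) B)
arcs-filter F P S B = trans (∑-cong S (λ u → ∑-filter P B (bit ∘ F u)))
  (∑-+ S (λ u → ∑ (filter (T? ∘ P) B) (bit ∘ F u)) (λ u → ∑ (filter (¬? ∘ T? ∘ P) B) (bit ∘ F u)))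

-- Split B according to adjacency to each vertex of S in turn. At the end B falls into at most
-- 2 ^ |S| classes, each completely joined to its trace A on S and to nothing else in S; a class
-- without biclique contributes |A| * |B| ≤ p * |B| + p * |A| arcs.
biclique-or-sparse : (F : ArcSet n) (p : ℕ) (S A B : List (Fin n)) →
  Unique S → Unique A → Unique B → (∀ {x} → x ∈ S → x ∉ A) →
  (∀ {a b} → a ∈ A → b ∈ B → T (F a b)) →
  Biclique F p p ⊎
  (arcs F S B + length A * length B ≤ p * length B + p * (length A + length S) * 2 ^ length S)
biclique-or-sparse F p [] A B uS uA uB S∉A AB with p ≤? length A | p ≤? length B
... | yes p≤A | yes p≤B = inj₁ record
  { left = take p A ; right = take p B
  ; left-unique = Unique.take⁺ p uA ; right-unique = Unique.take⁺ p uB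
  ; left-length = length-take-≤ p≤A ; right-length = length-take-≤ p≤B
  ; complete = λ a∈ b∈ → AB (∈-take⁻ p a∈) (∈-take⁻ p b∈) }
... | no p≰A | _ = inj₂ (m≤n⇒m≤n+o _ (*-monoˡ-≤ (length B) (<⇒≤ (≰⇒> p≰A))))
... | _ | no p≰B = inj₂ (m≤n⇒m≤o+n (p * length B)
  (≤-trans (*-monoʳ-≤ (length A) (<⇒≤ (≰⇒> p≰B))) (≤-reflexive (reshape (length A) p))))
  where
  reshape : ∀ a p → a * p ≡ p * (a + 0) * 1
  reshape = solve-∀
biclique-or-sparse F p (x ∷ S) A B (x∉S ∷ uS) uA uB S∉A AB
  with biclique-or-sparse F p S (x ∷ A) (filter (T? ∘ F x) B) uS
         (All.¬Any⇒All¬ A (S∉A (here refl)) ∷ uA) (Unique.filter⁺ (T? ∘ F x) uB)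
         (λ { y∈S (here refl) → All.lookup x∉S y∈S refl ; y∈S (there y∈A) → S∉A (there y∈S) y∈A })
         (λ { (here refl) b∈ → proj₂ (∈-filter⁻ (T? ∘ F x) {xs = B} b∈)
            ; (there a∈) b∈ → AB a∈ (proj₁ (∈-filter⁻ (T? ∘ F x) {xs = B} b∈)) })
... | inj₁ K = inj₁ K
... | inj₂ bound₁
  with biclique-or-sparse F p S A (filter (¬? ∘ T? ∘ F x) B) uS uA (Unique.filter⁺ (¬? ∘ T? ∘ F x) uB)
         (S∉A ∘ there) (λ a∈ b∈ → AB a∈ (proj₁ (∈-filter⁻ (¬? ∘ T? ∘ F x) {xs = B} b∈)))
... | inj₁ K = inj₁ K
... | inj₂ bound₀ = inj₂ (begin
  (∑ B (bit ∘ F x) + arcs F S B) + a * length B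
    ≡⟨ cong₂ _+_ (cong₂ _+_ (∑-bit (F x) B) (arcs-filter F (F x) S B)) (cong (a *_) (length-filter (F x) B)) ⟩
  (b₁ + (e₁ + e₀)) + a * (b₁ + b₀)
    ≡⟨ regroup a b₁ b₀ e₁ e₀ ⟩
  (e₁ + suc a * b₁) + (e₀ + a * b₀)
    ≤⟨ +-mono-≤ bound₁ bound₀ ⟩
  (p * b₁ + p * (suc a + s) * 2 ^ s) + (p * b₀ + p * (a + s) * 2 ^ s)
    -- The sum |A| + |S| is unchanged when x moves from S to A. Raising the other branch to the same
    -- value makes the two last terms equal, and their sum gives the extra factor 2.
    ≤⟨ +-monoʳ-≤ (p * b₁ + p * (suc a + s) * 2 ^ s)
         (+-monoʳ-≤ (p * b₀) (*-monoˡ-≤ (2 ^ s) (*-monoʳ-≤ p (n≤1+n (a + s))))) ⟩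
  (p * b₁ + p * (suc a + s) * 2 ^ s) + (p * b₀ + p * (suc a + s) * 2 ^ s)
    ≡⟨ double p a b₁ b₀ s (2 ^ s) ⟩
  p * (b₁ + b₀) + p * (a + suc s) * 2 ^ suc s
    ≡⟨ cong (λ b → p * b + p * (a + suc s) * 2 ^ suc s) (length-filter (F x) B) ⟨
  p * length B + p * (a + suc s) * 2 ^ suc s ∎)
  where
  open ≤-Reasoning
  a = length A
  s = length S
  b₁ = length (filter (T? ∘ F x) B)
  b₀ = length (filter (¬? ∘ T? ∘ F x) B)
  e₁ = arcs F S (filter (T? ∘ F x) B)
  e₀ = arcs F S (filter (¬? ∘ T? ∘ F x) B)
  regroup : ∀ a b₁ b₀ e₁ e₀ → (b₁ + (e₁ + e₀)) + a * (b₁ + b₀) ≡ (e₁ + suc a * b₁) + (e₀ + a * b₀)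
  regroup = solve-∀
  double : ∀ p a b₁ b₀ s t → (p * b₁ + p * (suc a + s) * t) + (p * b₀ + p * (suc a + s) * t) ≡
                             p * (b₁ + b₀) + p * (a + suc s) * (2 * t)
  double = solve-∀

arcs-++ : (F : ArcSet n) (S S′ B : List (Fin n)) → arcs F (S ++ S′) B ≡ arcs F S B + arcs F S′ B
arcs-++ F []      S′ B = refl
arcs-++ F (x ∷ S) S′ B = trans (cong (∑ B (bit ∘ F x) +_) (arcs-++ F S S′ B)) (sym (+-assoc (∑ B (bit ∘ F x)) _ _))

-- The factor 2 ^ |S| is affordable only for short S, so S is cut into q blocks of length at most s,
-- each tested against the whole of B.
biclique-or-sparse-blocks : (F : ArcSet n) (p s q : ℕ) (S B : List (Fin n)) →
  Unique S → Unique B → length S ≤ q * s →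
  Biclique F p p ⊎ arcs F S B ≤ q * (p * length B + p * s * 2 ^ s)
biclique-or-sparse-blocks F p s zero    []       B uS uB S≤ = inj₂ z≤n
biclique-or-sparse-blocks F p s (suc q) S B uS uB S≤
  with biclique-or-sparse F p (take s S) [] B (Unique.take⁺ s uS) [] uB (λ _ ()) (λ ())
... | inj₁ K = inj₁ K
... | inj₂ bound
  with biclique-or-sparse-blocks F p s q (drop s S) B (Unique.drop⁺ s uS) uB
         (≤-trans (≤-reflexive (length-drop s S)) (m≤n+o⇒m∸n≤o _ s S≤))
... | inj₁ K = inj₁ K
... | inj₂ bounds = inj₂ (begin
  arcs F S B
    ≡⟨ cong (λ S → arcs F S B) (take++drop≡id s S) ⟨
  arcs F (take s S ++ drop s S) B
    ≡⟨ arcs-++ F (take s S) (drop s S) B ⟩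
  arcs F (take s S) B + arcs F (drop s S) B
    ≤⟨ +-mono-≤ (≤-trans (≤-reflexive (sym (+-identityʳ _))) bound) bounds ⟩
  (p * length B + p * length (take s S) * 2 ^ length (take s S)) + q * (p * length B + p * s * 2 ^ s)
    ≤⟨ +-monoˡ-≤ _ (+-monoʳ-≤ (p * length B) (*-mono-≤ (*-monoʳ-≤ p take≤s) (^-monoʳ-≤ 2 take≤s))) ⟩
  suc q * (p * length B + p * s * 2 ^ s) ∎)
  where
  open ≤-Reasoning
  take≤s : length (take s S) ≤ s
  take≤s = ≤-trans (≤-reflexive (length-take s S)) (m⊓n≤m s (length S))

-- Removing bicliques

-- The xor lets reversal parities add up in `reversal-remove`; when A and B are the sides of a
-- biclique of F it amounts to deletion.
remove : ArcSet n → List (Fin n) → List (Fin n) → ArcSet n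
remove F A B u v = F u v xor (χ A u ∧ χ B v)

module _ {F : ArcSet n} {p q : ℕ} (K : Biclique F p q) where
  open Biclique K

  private
    inside : ∀ u v → T (χ left u ∧ χ right v) → T (F u v)
    inside u v t with χ left u in eq | χ right v in eq′
    ... | true | true = complete (χ⇒∈ left (Equivalence.from T-≡ eq)) (χ⇒∈ right (Equivalence.from T-≡ eq′))

  remove-⊆ : ∀ u v → T (remove F left right u v) → T (F u v)
  remove-⊆ u v t with χ left u ∧ χ right v in eq
  ... | true  = inside u v (Equivalence.from T-≡ eq)
  ... | false = subst T (xor-identityʳ (F u v)) t

  size-remove : size F ≡ size (remove F left right) + p * q
  size-remove = begin
    size F
      ≡⟨ ∑-cong V (λ u → trans (∑-cong V (pointwise u)) (∑-+ V (bit ∘ remove F left right u) (λ v → bit (χ left u) * bit (χ right v)))) ⟩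
    ∑ V (λ u → ∑ V (bit ∘ remove F left right u) + ∑ V (λ v → bit (χ left u) * bit (χ right v)))
      ≡⟨ ∑-+ V _ _ ⟩
    size (remove F left right) + ∑ V (λ u → ∑ V (λ v → bit (χ left u) * bit (χ right v)))
      ≡⟨ cong (size (remove F left right) +_) (trans (∑-cong V (λ u → ∑-*ˡ V (bit (χ left u)) (bit ∘ χ right))) (∑-*ʳ V (bit ∘ χ left) _)) ⟩
    size (remove F left right) + ∑ V (bit ∘ χ left) * ∑ V (bit ∘ χ right)
      ≡⟨ cong (size (remove F left right) +_) (cong₂ _*_ (trans (∑-χ left-unique) left-length) (trans (∑-χ right-unique) right-length)) ⟩
    size (remove F left right) + p * q ∎
    where
    open ≡-Reasoning
    V = allFin n
    pointwise : ∀ u v → bit (F u v) ≡ bit (remove F left right u v) + bit (χ left u) * bit (χ right v)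
    pointwise u v with F u v | χ left u | χ right v | inside u v
    ... | true  | true  | true  | _ = refl
    ... | true  | true  | false | _ = refl
    ... | true  | false | _     | _ = refl
    ... | false | true  | true  | t = ⊥-elim (t _)
    ... | false | true  | false | _ = refl
    ... | false | false | _     | _ = refl

-- Reversing an arc set

-- The pair {s , t} may be reversed too: when s and t are consecutive in an ordering of the
-- vertices, this does not affect acyclicity.
Reversal : ℕ → Fin n → Fin n → ArcSet n → ℕ → Set
Reversal {n} p s t F k = Σ (List (List (Fin n))) λ xss →
  All (λ xs → Unique xs × length xs ≡ p) xss × length xss ≤ k × ∃ λ c →
  ∀ u v → u ≢ v → parity xss u v ≡ (F u v xor F v u) xor (c ∧ κ (s ∷ t ∷ []) u v)

reversal-remove : ∀ {p k l} (s t : Fin n) (F : ArcSet n) (A B : List (Fin n)) →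
  Reversal p s t (λ u v → χ A u ∧ χ B v) k → Reversal p s t (remove F A B) l → Reversal p s t F (k + l)
reversal-remove s t F A B (xss , pxss , xss≤ , c , xss≗) (yss , pyss , yss≤ , d , yss≗) =
  xss ++ yss , All.++⁺ pxss pyss ,
  ≤-trans (≤-reflexive (length-++ xss)) (+-mono-≤ xss≤ yss≤) , (c xor d) ,
  λ u v u≢v → trans (parity-++ xss yss u v) (trans (cong₂ _xor_ (xss≗ u v u≢v) (yss≗ u v u≢v))
    (solve 7 (λ c d ab ba f f′ k → ((ab :+ ba) :+ (c :* k)) :+ (((f :+ ab) :+ (f′ :+ ba)) :+ (d :* k))
                := (f :+ f′) :+ ((c :+ d) :* k))
      refl c d (χ A u ∧ χ B v) (χ A v ∧ χ B u) (F u v) (F v u) (κ (s ∷ t ∷ []) u v)))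
  where open Data.Bool.Solver.xor-∧-Solver

halves : ∀ {h} (xs : List A) → length xs ≡ h + h → Unique xs →
  Σ (List A) λ ys → Σ (List A) λ zs → ys ++ zs ≡ xs ×
  (length ys ≡ h × Unique ys) × (length zs ≡ h × Unique zs)
halves {h = h} xs len uniq = take h xs , drop h xs , take++drop≡id h xs ,
  (length-take-≤ (≤-trans (m≤m+n h h) (≤-reflexive (sym len))) , Unique.take⁺ h uniq) ,
  (trans (length-drop h xs) (trans (cong (_∸ h) len) (m+n∸n≡m h h)) , Unique.drop⁺ h uniq)

-- A vertex common to X and Y would carry a loop of F, so the two sides are disjoint.
joined-sides : ∀ {h l} {F : ArcSet n} → (∀ u → ¬ T (F u u)) → {X Y : List (Fin n)} →
  length X ≡ h × Unique X → length Y ≡ l × Unique Y → (∀ {a b} → a ∈ X → b ∈ Y → T (F a b)) →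
  Unique (X ++ Y) × length (X ++ Y) ≡ h + l
joined-sides irrefl {X} (lX , uX) (lY , uY) XY =
  Unique.++⁺ uX uY (λ (x∈X , x∈Y) → irrefl _ (XY x∈X x∈Y)) , trans (length-++ X) (cong₂ _+_ lX lY)

reversal-biclique : ∀ {h} {s t : Fin n} {F : ArcSet n} → (∀ u → ¬ T (F u u)) →
  (K : Biclique F (h + h) (h + h)) → let open Biclique K in
  Reversal (h + h) s t (λ u v → χ left u ∧ χ right v) 4
reversal-biclique {n} {h} irrefl
  record { left = A ; right = B ; left-unique = uA ; right-unique = uB ; left-length = lA ; right-length = lB ; complete = AB }
  with A₁ , A₂ , refl , pA₁ , pA₂ ← halves {h = h} A lA uA
  with B₁ , B₂ , refl , pB₁ , pB₂ ← halves {h = h} B lB uB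
  with xss , pxss , xss≤ , xss≗ ← realised-biclique {p = h + h} A₁ A₂ B₁ B₂
    ( joined-sides irrefl pA₁ pB₁ (λ a∈ b∈ → AB (∈-++⁺ˡ a∈) (∈-++⁺ˡ b∈))
    ∷ joined-sides irrefl pA₁ pB₂ (λ a∈ b∈ → AB (∈-++⁺ˡ a∈) (∈-++⁺ʳ B₁ b∈))
    ∷ joined-sides irrefl pA₂ pB₁ (λ a∈ b∈ → AB (∈-++⁺ʳ A₁ a∈) (∈-++⁺ˡ b∈))
    ∷ joined-sides irrefl pA₂ pB₂ (λ a∈ b∈ → AB (∈-++⁺ʳ A₁ a∈) (∈-++⁺ʳ B₁ b∈)) ∷ [])
  = xss , pxss , xss≤ , false , λ u v _ → trans (xss≗ u v) (sym (xor-identityʳ _))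

δ-≢ : (a : Fin n) {u v : Fin n} → u ≢ v → does (a Fin.≟ u) ∧ does (a Fin.≟ v) ≡ false
δ-≢ a {u} {v} u≢v with a Fin.≟ u | a Fin.≟ v
... | yes a≡u | yes a≡v = contradiction (trans (sym a≡u) a≡v) u≢v
... | yes _   | no _    = refl
... | no _    | _       = refl

-- The two sides differ by the diagonal terms of a and of b, which vanish for u ≢ v. This is why
-- `Reversal` speaks of distinct vertices only.
κ-pair : (a b : Fin n) {u v : Fin n} → u ≢ v →
  κ (a ∷ b ∷ []) u v ≡ (χ (a ∷ []) u ∧ χ (b ∷ []) v) xor (χ (a ∷ []) v ∧ χ (b ∷ []) u)
κ-pair a b {u} {v} u≢v = trans
  (solve 4 (λ au bu av bv → (au :+ (bu :+ con false)) :* (av :+ (bv :+ con false))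
      := (((au :+ con false) :* (bv :+ con false)) :+ ((av :+ con false) :* (bu :+ con false))) :+ ((au :* av) :+ (bu :* bv)))
    refl (does (a Fin.≟ u)) (does (b Fin.≟ u)) (does (a Fin.≟ v)) (does (b Fin.≟ v)))
  (trans (cong₂ (λ x y → ((χ (a ∷ []) u ∧ χ (b ∷ []) v) xor (χ (a ∷ []) v ∧ χ (b ∷ []) u)) xor (x xor y)) (δ-≢ a u≢v) (δ-≢ b u≢v))
         (xor-identityʳ _))
  where open Data.Bool.Solver.xor-∧-Solver

reversal-arc : ∀ k {s t a b : Fin n} → 3 + (k + (k + k)) ≤ n → s ≢ t → a ≢ b →
  Reversal (2 + (k + k)) s t (λ u v → χ (a ∷ []) u ∧ χ (b ∷ []) v) 12
reversal-arc k {s} {t} {a} {b} 3k≤n s≢t a≢b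
  with xss , pxss , xss≤ , xss≗ ← realised-edges k 3k≤n a≢b s≢t
  = xss , pxss , xss≤ , true , λ u v u≢v →
    trans (xss≗ u v) (cong (_xor κ (s ∷ t ∷ []) u v) (κ-pair a b u≢v))

-- An arc is a 1 × 1 biclique, so `remove` and `size-remove` apply to it as well. The bound m on the
-- number of arcs drives the recursion.
reversal-singly : ∀ k {s t : Fin n} → 3 + (k + (k + k)) ≤ n → s ≢ t →
  (m : ℕ) (F : ArcSet n) → (∀ u → ¬ T (F u u)) → size F ≤ m → Reversal (2 + (k + k)) s t F (12 * m)
reversal-singly k {s} {t} 3k≤n s≢t m F irrefl F≤m with Fin.any? (λ u → Fin.any? (λ v → T? (F u v)))
... | no ¬arc = [] , [] , z≤n , false , λ u v _ → sym (cong₂ (λ x y → (x xor y) xor false) (absent u v) (absent v u))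
  where
  absent : ∀ u v → F u v ≡ false
  absent u v with F u v in eq
  ... | false = refl
  ... | true  = contradiction (u , v , Equivalence.from T-≡ eq) ¬arc
... | yes (u , v , Fuv) = go m F≤m
  where
  K : Biclique F 1 1
  K = record
    { left = u ∷ [] ; right = v ∷ [] ; left-unique = [] ∷ [] ; right-unique = [] ∷ []
    ; left-length = refl ; right-length = refl ; complete = λ { (here refl) (here refl) → Fuv } }
  go : ∀ m → size F ≤ m → Reversal (2 + (k + k)) s t F (12 * m)
  go m F≤m with m | ≤-trans (≤-reflexive (trans (+-comm 1 _) (sym (size-remove K)))) F≤m
  ... | suc m′ | s≤s F′≤m′ = subst (Reversal (2 + (k + k)) s t F) (sym (*-suc 12 m′))
    (reversal-remove s t F (u ∷ []) (v ∷ []) (reversal-arc k {a = u} {v} 3k≤n s≢t λ { refl → irrefl u Fuv })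
      (reversal-singly k 3k≤n s≢t m′ (remove F (u ∷ []) (v ∷ [])) (λ w → irrefl w ∘ remove-⊆ K w w) F′≤m′))

-- A biclique with sides 2h has 4h² arcs and costs 4 inversions, hence h² arcs per inversion. Once
-- no biclique is found, at most `ex` arcs remain, at 12 inversions each.
reversal-greedy : ∀ k ex {s t : Fin n} → 3 + (k + (k + k)) ≤ n → s ≢ t → let h = suc k in
  (∀ (F : ArcSet n) → Biclique F (h + h) (h + h) ⊎ size F ≤ ex) →
  (m : ℕ) (F : ArcSet n) → (∀ u → ¬ T (F u u)) → size F ≤ m →
  ∃ λ l → Reversal (h + h) s t F l × h * h * l ≤ size F + h * h * (12 * ex)
reversal-greedy k ex {s} {t} 3k≤n s≢t find m F irrefl F≤m with find F
... | inj₂ F≤ex = 12 * ex ,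
  subst (λ p → Reversal p s t F (12 * ex)) (sym (cong suc (+-suc k k)))
    (reversal-singly k 3k≤n s≢t ex F irrefl F≤ex) ,
  m≤n+m _ (size F)
... | inj₁ K = go m F≤m
  where
  open Biclique K
  open ≤-Reasoning
  h = suc k
  F′ = remove F left right
  go : ∀ m → size F ≤ m → ∃ λ l → Reversal (h + h) s t F l × h * h * l ≤ size F + h * h * (12 * ex)
  go m F≤m with m | ≤-trans (≤-reflexive (trans (+-comm ((h + h) * (h + h)) (size F′)) (sym (size-remove K)))) F≤m
  -- As h is a successor, the biclique has at least one arc, which forces m to be a successor too.
  ... | suc m′ | s≤s F′≤m′
    with l , rev , l≤ ← reversal-greedy k ex 3k≤n s≢t find m′ F′ (λ w → irrefl w ∘ remove-⊆ K w w)
                          (m+n≤o⇒n≤o _ F′≤m′)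
    = 4 + l , reversal-remove s t F left right (reversal-biclique {h = h} {s} {t} irrefl K) rev , (begin
      h * h * (4 + l)                                          ≡⟨ expand h l ⟩
      h * h * l + (h + h) * (h + h)                            ≤⟨ +-monoˡ-≤ _ l≤ ⟩
      (size F′ + h * h * (12 * ex)) + (h + h) * (h + h)        ≡⟨ reorder (size F′) (h * h * (12 * ex)) ((h + h) * (h + h)) ⟩
      (size F′ + (h + h) * (h + h)) + h * h * (12 * ex)        ≡⟨ cong (_+ h * h * (12 * ex)) (size-remove K) ⟨
      size F + h * h * (12 * ex)                               ∎)
    where
    expand : ∀ h l → h * h * (4 + l) ≡ h * h * l + (h + h) * (h + h)
    expand = solve-∀
    reorder : ∀ x y z → (x + y) + z ≡ (x + z) + y
    reorder = solve-∀

-- Topological orderings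

-- The transitive closure of an acyclic arc relation is a strict partial order on a finite set,
-- hence well-founded, and so is the relation below it.
acyclic⇒wellFounded : (E : Digraph n) → Acyclic E → WellFounded (Arc E)
acyclic⇒wellFounded E acyclic = Plus.wellFounded⁻ (Arc E) (spo-wellFounded {_≈_ = _≡_} record
  { isEquivalence = isEquivalence
  ; irrefl        = λ { refl → acyclic _ }
  ; trans         = Plus.transitive (Arc E)
  ; <-resp-≈      = (λ { refl x → x }) , (λ { refl x → x }) })

module _ (E : Digraph n) where

  private
    -- Hands the proof of X to `f`: the recursive call in `height` needs the arc to obtain its
    -- accessibility argument.
    above : ∀ {X : Set} → Dec X → (X → ℕ) → ℕ
    above (yes x) f = suc (f x)
    above (no _)  f = 0

    above-cong : ∀ {X : Set} (d : Dec X) {f g : X → ℕ} → (∀ x → f x ≡ g x) → above d f ≡ above d g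
    above-cong (yes x) f≗g = cong suc (f≗g x)
    above-cong (no _)  f≗g = refl

    above-< : ∀ {X : Set} (d : Dec X) {f : X → ℕ} {m : ℕ} → X → (∀ x → f x ≡ m) → m < above d f
    above-< (yes x) _ f≡m = s≤s (≤-reflexive (sym (f≡m x)))
    above-< (no ¬x) x _   = contradiction x ¬x

  -- Any function that increases along arcs would do. With a sum over the in-neighbours, each
  -- summand alone exceeds the height of its in-neighbour.
  height : ∀ v → Acc (Arc E) v → ℕ
  height v (acc rs) = ∑ (allFin n) λ u → above (T? (E u v)) (λ e → height u (rs e))

  height-irrelevant : ∀ v (a b : Acc (Arc E) v) → height v a ≡ height v b
  height-irrelevant v (acc rs) (acc rs′) = ∑-cong (allFin n) λ u →
    above-cong (T? (E u v)) (λ e → height-irrelevant u (rs e) (rs′ e))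

  height-< : ∀ {u v} (a : Acc (Arc E) u) (b : Acc (Arc E) v) → Arc E u v → height u a < height v b
  height-< {u} {v} a (acc rs) e = <-≤-trans
    (above-< (T? (E u v)) e (λ e′ → height-irrelevant u (rs e′) a))
    (∑-∈ (λ u → above (T? (E u v)) (λ e → height u (rs e))) (∈-allFin u))

  topological-rank : Acyclic E → Σ (Fin n → ℕ) λ r →
    (∀ u v → r u ≡ r v → u ≡ v) × (∀ u v → Arc E u v → r u < r v)
  topological-rank acyclic = rank , rank-injective , rank-<
    where
    wf = acyclic⇒wellFounded E acyclic
    h : Fin n → ℕ
    h u = height u (wf u)
    rank : Fin n → ℕ
    -- The index breaks ties between equal heights; being less than n, it is recovered as the
    -- residue modulo n and never outweighs a difference in height.
    rank u = toℕ u + h u * n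
    rank-injective : ∀ u v → rank u ≡ rank v → u ≡ v
    rank-injective u v eq = Fin.toℕ-injective (trans (sym (residue u)) (trans (cong (_% n) eq) (residue v)))
      where
      instance _ = Fin.nonZeroIndex u
      residue : ∀ w → rank w % n ≡ toℕ w
      residue w = trans ([m+kn]%n≡m%n (toℕ w) (h w) n) (m<n⇒m%n≡m (Fin.toℕ<n w))
    rank-< : ∀ u v → Arc E u v → rank u < rank v
    rank-< u v e = <-≤-trans (+-monoˡ-< (h u * n) (Fin.toℕ<n u))
      (≤-trans (*-monoˡ-≤ n (height-< (wf u) (wf v) e)) (m≤n+m (h v * n) (toℕ v)))

rank⇒acyclic : (E : Digraph n) (r : Fin n → ℕ) → (∀ u v → Arc E u v → r u < r v) → Acyclic E
rank⇒acyclic E r mono v cycle = <-irrefl refl (mono⁺ cycle)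
  where
  mono⁺ : ∀ {u v} → TransClosure (Arc E) u v → r u < r v
  mono⁺ [ e ]    = mono _ _ e
  mono⁺ (e ∷ es) = <-trans (mono _ _ e) (mono⁺ es)

least : (r : Fin n → ℕ) (xs : List (Fin n)) → 1 ≤ length xs →
        ∃ λ x → x ∈ xs × (∀ {y} → y ∈ xs → r x ≤ r y)
least r (x ∷ []) _ = x , here refl , λ { (here refl) → ≤-refl }
least r (x ∷ x′ ∷ xs) _ with least r (x′ ∷ xs) (s≤s z≤n)
... | z , z∈ , z≤ with ≤-total (r x) (r z)
...   | inj₁ x≤z = x , here refl , λ { (here refl) → ≤-refl ; (there y∈) → ≤-trans x≤z (z≤ y∈) }
...   | inj₂ z≤x = z , there z∈ , λ { (here refl) → z≤x ; (there y∈) → z≤ y∈ }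

-- Provides the pair {s , t} of `Reversal`: two consecutive vertices at the bottom of the ordering.
two-least : (r : Fin n → ℕ) → (∀ u v → r u ≡ r v → u ≡ v) → 2 ≤ n →
  ∃ λ s → ∃ λ t → r s < r t × (∀ w → w ≢ s → w ≢ t → r t < r w)
two-least {n} r inj 2≤n
  with s , _ , s≤ ← least r (allFin n) (≤-trans (<⇒≤ 2≤n) (≤-reflexive (sym (length-tabulate {n = n} id))))
  with t , t∈ , t≤ ← least r (without (s ∷ [])) (+-cancelˡ-≤ 1 _ _ (≤-trans 2≤n (length-without (s ∷ []))))
  = s , t , ≤∧≢⇒< (s≤ (∈-allFin t)) (λ eq → without-∉ (s ∷ []) t∈ (here (inj _ _ (sym eq)))) ,
    λ w w≢s w≢t → ≤∧≢⇒< (t≤ (∈-filter⁺ (λ x → ¬? (s Fin.≟ x)) (∈-allFin w) (w≢s ∘ sym)))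
                        (λ eq → w≢t (inj _ _ (sym eq)))

-- Acyclicity after reversing the backward arcs

module _ (D : Digraph n) (oriented : IsOriented D)
         (r : Fin n → ℕ) (r-injective : ∀ u v → r u ≡ r v → u ≡ v) where

  backward : ArcSet n
  backward u v = D u v ∧ does (r v <? r u)

  backward-irreflexive : ∀ u → ¬ T (backward u u)
  backward-irreflexive u t with D u u in eq
  ... | true = proj₁ oriented u (Equivalence.from T-≡ eq)

  -- The xor holds exactly at the pairs joined by a backward arc. Since D has no opposite arcs,
  -- flipping such a pair leaves only the ascending direction.
  forward : ∀ u v → u ≢ v → T (if backward u v xor backward v u then D v u else D u v) → r u < r v
  forward u v u≢v t with <-cmp (r u) (r v)
  ... | tri< ru<rv _ _ = ru<rv
  ... | tri≈ _ ru≡rv _ = contradiction (r-injective u v ru≡rv) u≢v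
  ... | tri> ru≮rv _ rv<ru
    rewrite dec-true (r v <? r u) rv<ru | dec-false (r u <? r v) ru≮rv
    with D u v | D v u | proj₂ oriented u v
  ... | true  | true  | asym = contradiction _ (asym _)
  ... | true  | false | _    = contradiction t (λ ())
  ... | false | true  | _    = contradiction t (λ ())
  ... | false | false | _    = contradiction t (λ ())

  -- If `c` is false, r itself increases along all arcs. If `c` is true, exchanging s and t in the
  -- ordering repairs the extra flip, and no other comparison changes because both lie below all
  -- other vertices.
  reversal-acyclic : ∀ {s t} → r s < r t → (∀ w → w ≢ s → w ≢ t → r t < r w) →
    (E : Digraph n) (c : Bool) → (∀ u → ¬ T (E u u)) →
    (∀ u v → u ≢ v →
      E u v ≡ (if (backward u v xor backward v u) xor (c ∧ κ (s ∷ t ∷ []) u v) then D v u else D u v)) →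
    Acyclic E
  reversal-acyclic {s} {t} s<t t< E false irrefl E≗ = rank⇒acyclic E r λ u v e →
    let u≢v = λ { refl → irrefl u e } in
    forward u v u≢v (subst T (trans (E≗ u v u≢v) (cong (if_then D v u else D u v) (xor-identityʳ _))) e)
  reversal-acyclic {s} {t} s<t t< E true irrefl E≗ = rank⇒acyclic E r′ mono
    where
    -- Now t comes first and s second; the shift by 2 keeps all other vertices above them in their
    -- old order.
    r′ : Fin n → ℕ
    r′ w with w Fin.≟ s | w Fin.≟ t
    ... | yes _ | _     = 1
    ... | no _  | yes _ = 0
    ... | no _  | no _  = 2 + r w

    unswapped : ∀ u v → u ≢ v → κ (s ∷ t ∷ []) u v ≡ false → T (E u v) → r u < r v
    unswapped u v u≢v κ≡ e = forward u v u≢v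
      (subst T (trans (E≗ u v u≢v) (cong (if_then D v u else D u v) (trans (cong ((backward u v xor backward v u) xor_) κ≡) (xor-identityʳ _)))) e)

    swapped : ∀ u v → u ≢ v → κ (s ∷ t ∷ []) u v ≡ true → T (E u v) → r v < r u
    swapped u v u≢v κ≡ e = forward v u (u≢v ∘ sym)
      (subst T (trans (E≗ u v u≢v) (trans (cong (λ k → if (backward u v xor backward v u) xor k then D v u else D u v) κ≡)
        (flip (backward u v) (backward v u)))) e)
      where
      flip : ∀ x y → (if (x xor y) xor true then D v u else D u v) ≡ (if y xor x then D u v else D v u)
      flip true  true  = refl
      flip true  false = refl
      flip false true  = refl
      flip false false = refl

    s≢t : s ≢ t
    s≢t refl = <-irrefl refl s<t

    χ-s : χ (s ∷ t ∷ []) s ≡ true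
    χ-s rewrite dec-true (s Fin.≟ s) refl | dec-false (t Fin.≟ s) (s≢t ∘ sym) = refl
    χ-t : χ (s ∷ t ∷ []) t ≡ true
    χ-t rewrite dec-true (t Fin.≟ t) refl | dec-false (s Fin.≟ t) s≢t = refl
    χ-other : ∀ {w} → w ≢ s → w ≢ t → χ (s ∷ t ∷ []) w ≡ false
    χ-other {w} w≢s w≢t rewrite dec-false (s Fin.≟ w) (w≢s ∘ sym) | dec-false (t Fin.≟ w) (w≢t ∘ sym) = refl

    mono : ∀ u v → T (E u v) → r′ u < r′ v
    mono u v e with u Fin.≟ s | u Fin.≟ t | v Fin.≟ s | v Fin.≟ t
    ... | yes refl | _        | yes refl | _        = contradiction e (irrefl u)
    ... | yes refl | _        | no _     | yes refl = contradiction (swapped s t s≢t (cong₂ _∧_ χ-s χ-t) e) (<⇒≯ s<t)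
    ... | yes refl | _        | no _     | no _     = s≤s (s≤s z≤n)
    ... | no _     | yes refl | yes refl | _        = s≤s z≤n
    ... | no _     | yes refl | no _     | yes refl = contradiction e (irrefl u)
    ... | no _     | yes refl | no _     | no _     = s≤s z≤n
    ... | no u≢s   | no u≢t   | yes refl | _        = contradiction
      (unswapped u v u≢s (cong (_∧ χ (s ∷ t ∷ []) v) (χ-other u≢s u≢t)) e) (<⇒≯ (<-trans s<t (t< u u≢s u≢t)))
    ... | no u≢s   | no u≢t   | no _     | yes refl = contradiction
      (unswapped u v u≢t (cong (_∧ χ (s ∷ t ∷ []) v) (χ-other u≢s u≢t)) e) (<⇒≯ (t< u u≢s u≢t))
    ... | no u≢s   | no u≢t   | no v≢s   | no v≢t   = s≤s (s≤s
      (unswapped u v (λ { refl → irrefl u e }) (cong (_∧ χ (s ∷ t ∷ []) v) (χ-other u≢s u≢t)) e))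

-- The error term

log₄ : ℕ → ℕ
log₄ zero    = 0
log₄ (suc n) with 4 ^ suc (log₄ n) ≤? suc n
... | yes _ = suc (log₄ n)
... | no  _ = log₄ n

-- The successor on the right covers n = 0, where `log₄` takes the default value 0.
4^log₄≤ : ∀ n → 4 ^ log₄ n ≤ suc n
4^log₄≤ zero = ≤-refl
4^log₄≤ (suc n) with 4 ^ suc (log₄ n) ≤? suc n
... | yes 4^≤ = m≤n⇒m≤1+n 4^≤
... | no  _   = m≤n⇒m≤1+n (4^log₄≤ n)

<4^suc-log₄ : ∀ n → n < 4 ^ suc (log₄ n)
<4^suc-log₄ zero = s≤s z≤n
<4^suc-log₄ (suc n) with 4 ^ suc (log₄ n) ≤? suc n
... | yes _   = ≤-<-trans (<4^suc-log₄ n) (^-monoʳ-< 4 (s≤s (s≤s z≤n)) (n<1+n (suc (log₄ n))))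
... | no  4^≰ = ≰⇒> 4^≰

n<2^n : ∀ n → n < 2 ^ n
n<2^n zero    = s≤s z≤n
n<2^n (suc n) = +-mono-≤ (m^n>0 2 n) (≤-trans (n<2^n n) (m≤m+n (2 ^ n) 0))

n*2^n≤4^n : ∀ n → n * 2 ^ n ≤ 4 ^ n
n*2^n≤4^n n = ≤-trans (*-monoˡ-≤ (2 ^ n) (<⇒≤ (n<2^n n))) (≤-reflexive (2^*2^ n))
  where
  square : ∀ x → 2 * x * (2 * x) ≡ 4 * (x * x)
  square = solve-∀
  2^*2^ : ∀ n → 2 ^ n * 2 ^ n ≡ 4 ^ n
  2^*2^ zero    = refl
  2^*2^ (suc n) = trans (square (2 ^ n)) (cong (4 *_) (2^*2^ n))

-- Logarithmic length S keeps S * 2 ^ S ≤ 4 ^ S linear in n while the number of blocks is o(n). The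
-- successor keeps the divisor nonzero.
block : ℕ → ℕ
block n = suc (log₄ n)

4^block≤ : ∀ n → 1 ≤ n → 4 ^ block n ≤ 8 * n
4^block≤ n 1≤n = begin
  4 * 4 ^ log₄ n    ≤⟨ *-monoʳ-≤ 4 (4^log₄≤ n) ⟩
  4 * (1 + n)       ≤⟨ *-monoʳ-≤ 4 (+-monoˡ-≤ n 1≤n) ⟩
  4 * (n + n)       ≡⟨ double n ⟩
  8 * n             ∎
  where
  open ≤-Reasoning
  double : ∀ n → 4 * (n + n) ≡ 8 * n
  double = solve-∀

m≤suc[m/n]*n : ∀ m n .{{_ : NonZero n}} → m ≤ suc (m / n) * n
m≤suc[m/n]*n m n = ≤-trans (≤-reflexive (m≡m%n+[m/n]*n m n)) (+-monoˡ-≤ _ (m%n≤n m n))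

-- Number of blocks times the bound p n + 8 p n for one block, so of order p n² / log n.
sparse : ℕ → ℕ → ℕ
sparse p n = suc (n / block n) * (9 * p * n)

biclique-or-size≤ : ∀ p → 1 ≤ n → (F : ArcSet n) → Biclique F p p ⊎ size F ≤ sparse p n
biclique-or-size≤ {n} p 1≤n F
  with biclique-or-sparse-blocks F p (block n) (suc (n / block n)) (allFin n) (allFin n)
         (Unique.allFin⁺ n) (Unique.allFin⁺ n) (≤-trans (≤-reflexive (length-tabulate {n = n} id)) (m≤suc[m/n]*n n (block n)))
... | inj₁ K = inj₁ K
... | inj₂ bound = inj₂ (≤-trans bound (*-monoʳ-≤ (suc (n / block n)) (begin
  p * length (allFin n) + p * S * 2 ^ S    ≡⟨ cong₂ _+_ (cong (p *_) (length-tabulate {n = n} id)) (*-assoc p S (2 ^ S)) ⟩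
  p * n + p * (S * 2 ^ S)                  ≤⟨ +-monoʳ-≤ (p * n) (*-monoʳ-≤ p (≤-trans (n*2^n≤4^n S) (4^block≤ n 1≤n))) ⟩
  p * n + p * (8 * n)                      ≡⟨ collect p n ⟩
  9 * p * n                                ∎)))
  where
  open ≤-Reasoning
  S = block n
  collect : ∀ p n → p * n + p * (8 * n) ≡ 9 * p * n
  collect = solve-∀

-- For n ≥ 4 ^ (p b) the block length S is at least p b and absorbs that factor. Then S (n / S + 1)
-- ≤ n + 8 n, and the other factor 9 n yields 81 n².
sparse-littleO : ∀ p b n → 4 ^ (p * b) ≤ n → b * sparse p n ≤ 81 * (n * n)
sparse-littleO p b n 4^≤n = begin
  b * (suc (n / S) * (9 * p * n))          ≡⟨ regroup b (suc (n / S)) p n ⟩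
  p * b * suc (n / S) * (9 * n)            ≤⟨ *-monoˡ-≤ (9 * n) (*-monoˡ-≤ (suc (n / S)) pb≤S) ⟩
  S * suc (n / S) * (9 * n)                ≤⟨ *-monoˡ-≤ (9 * n) S*q≤ ⟩
  9 * n * (9 * n)                          ≡⟨ square n ⟩
  81 * (n * n)                             ∎
  where
  open ≤-Reasoning
  S = block n
  regroup : ∀ b q p n → b * (q * (9 * p * n)) ≡ p * b * q * (9 * n)
  regroup = solve-∀
  square : ∀ n → 9 * n * (9 * n) ≡ 81 * (n * n)
  square = solve-∀
  S≤8n : S ≤ 8 * n
  S≤8n = ≤-trans (≤-trans (m≤m*n S (2 ^ S) {{m^n≢0 2 S}}) (n*2^n≤4^n S))
                 (4^block≤ n (≤-trans (m^n>0 4 (p * b)) 4^≤n))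
  S*q≤ : S * suc (n / S) ≤ 9 * n
  S*q≤ = ≤-trans (≤-reflexive (trans (*-suc S (n / S)) (trans (+-comm S _) (cong (_+ S) (*-comm S (n / S))))))
                 (+-mono-≤ (m/n*n≤m n S) S≤8n)
  pb≤S : p * b ≤ S
  pb≤S with p * b ≤? S
  ... | yes pb≤S = pb≤S
  ... | no  pb≰S = contradiction (≤-trans (^-monoʳ-≤ 4 (<⇒≤ (≰⇒> pb≰S))) 4^≤n) (<⇒≱ (<4^suc-log₄ n))

error : ℕ → ℕ → ℕ
error p n = 12 * sparse p n

error-littleO : ∀ p b → ∃ λ N → ∀ n → N ≤ n → b * error p n ≤ n * n
-- The constants 12 and 81 are put into the multiplier beforehand, and 81 is cancelled at the end.
error-littleO p b = 4 ^ (p * (81 * (b * 12))) , λ n 4^≤n → *-cancelˡ-≤ 81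
  (≤-trans (≤-reflexive (regroup 81 b 12 (sparse p n))) (sparse-littleO p (81 * (b * 12)) n 4^≤n))
  where
  regroup : ∀ c b d x → c * (b * (d * x)) ≡ c * (b * d) * x
  regroup = solve-∀

-- From natural-number bounds to rational ones

ℕ/1 : ℕ → ℚ
ℕ/1 k = pos k ℚ./ 1

toℚᵘ-/ : ∀ i d → ℚ.toℚᵘ (i ℚ./ suc d) ℚᵘ.≃ mkℚᵘ i d
toℚᵘ-/ i d = ℚ.toℚᵘ-fromℚᵘ (mkℚᵘ i d)

-- A positive ε = (a + 1) / (d + 1) is at least 1 / (d + 1), so the hypothesis is applied with b = d
-- + 1.
littleOSq : (f : ℕ → ℕ) → (∀ b → ∃ λ N → ∀ n → N ≤ n → b * f n ≤ n * n) → LittleOSq (ℕ/1 ∘ f)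
littleOSq f small (mkℚ (pos zero)   d _) (ℚ.*<* (ℤ.+<+ ()))
littleOSq f small (mkℚ ℤ.-[1+ _ ] d _) (ℚ.*<* ())
littleOSq f small ε@(mkℚ (pos (suc a))  d _) _ with N , N≤⇒ ← small (suc d) = N , λ n N≤n →
  subst (ℚ._≤ ε ℚ.* ℕ/1 (n * n)) (sym (ℚ.0≤p⇒∣p∣≡p (ℚ.nonNegative⁻¹ _ {{ℚ.normalize-nonNeg (f n) 1}})))
    (ℚ.toℚᵘ-cancel-≤ (ℚᵘ.≤-respˡ-≃ (ℚᵘ.≃-sym (toℚᵘ-/ (pos (f n)) 0))
      (ℚᵘ.≤-respʳ-≃ (ℚᵘ.≃-sym (ℚᵘ.≃-trans (ℚ.toℚᵘ-homo-* ε (ℕ/1 (n * n)))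
                                 (ℚᵘ.*-congˡ {mkℚᵘ (pos (suc a)) d} (toℚᵘ-/ (pos (n * n)) 0))))
        (ℚᵘ.*≤* (cast n (N≤⇒ n N≤n))))))
  where
  cast : ∀ n → suc d * f n ≤ n * n →
    pos (f n) ℤ.* pos (suc d * 1) ℤ.≤ (pos (suc a) ℤ.* pos (n * n)) ℤ.* pos 1
  cast n df≤ = begin
    pos (f n) ℤ.* pos (suc d * 1)              ≡⟨ ℤ.pos-* (f n) (suc d * 1) ⟨
    pos (f n * (suc d * 1))                ≤⟨ ℤ.+≤+ bound ⟩
    pos (suc a * (n * n))                  ≡⟨ ℤ.pos-* (suc a) (n * n) ⟩
    pos (suc a) ℤ.* pos (n * n)                ≡⟨ ℤ.*-identityʳ _ ⟨
    (pos (suc a) ℤ.* pos (n * n)) ℤ.* pos 1      ∎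
    where
    open ℤ.≤-Reasoning
    bound : f n * (suc d * 1) ≤ suc a * (n * n)
    bound = ≤-trans (≤-reflexive (trans (cong (f n *_) (*-identityʳ (suc d))) (*-comm (f n) (suc d))))
                    (≤-trans df≤ (m≤m+n (n * n) (a * (n * n))))

ℕ/1≤divℕ+ℕ/1 : ∀ l m d e → suc d * l ≤ m + suc d * e → ℕ/1 l ℚ.≤ divℕ m (suc d) ℚ.+ ℕ/1 e
ℕ/1≤divℕ+ℕ/1 l m d e dl≤ = ℚ.toℚᵘ-cancel-≤ (ℚᵘ.≤-respˡ-≃ (ℚᵘ.≃-sym (toℚᵘ-/ (pos l) 0))
  (ℚᵘ.≤-respʳ-≃ (ℚᵘ.≃-sym (ℚᵘ.≃-trans (ℚ.toℚᵘ-homo-+ (divℕ m (suc d)) (ℕ/1 e))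
                             (ℚᵘ.+-cong (toℚᵘ-/ (pos m) d) (toℚᵘ-/ (pos e) 0))))
    (ℚᵘ.*≤* cast)))
  where
  cast : pos l ℤ.* pos (suc d * 1) ℤ.≤ (pos m ℤ.* pos 1 ℤ.+ pos e ℤ.* pos (suc d)) ℤ.* pos 1
  cast = begin
    pos l ℤ.* pos (suc d * 1)                            ≡⟨ ℤ.pos-* l (suc d * 1) ⟨
    pos (l * (suc d * 1))                              ≡⟨ cong pos (trans (cong (l *_) (*-identityʳ (suc d))) (*-comm l (suc d))) ⟩
    pos (suc d * l)                                    ≤⟨ ℤ.+≤+ dl≤ ⟩
    pos (m + suc d * e)                                ≡⟨ ℤ.pos-+ m (suc d * e) ⟩
    pos m ℤ.+ pos (suc d * e)                            ≡⟨ cong₂ ℤ._+_ (sym (ℤ.*-identityʳ (pos m))) (trans (cong pos (*-comm (suc d) e)) (ℤ.pos-* e (suc d))) ⟩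
    pos m ℤ.* pos 1 ℤ.+ pos e ℤ.* pos (suc d)                  ≡⟨ ℤ.*-identityʳ _ ⟨
    (pos m ℤ.* pos 1 ℤ.+ pos e ℤ.* pos (suc d)) ℤ.* pos 1        ∎
    where open ℤ.≤-Reasoning

-- Assembling the bound

-- The ordering is a topological one of D minus a feedback arc set of size m. All backward arcs then
-- lie in that set, so there are at most m of them.
invEqLe-greedy : ∀ k ex → let h = suc k in 3 + (k + (k + k)) ≤ n →
  (∀ (F : ArcSet n) → Biclique F (h + h) (h + h) ⊎ size F ≤ ex) →
  (D : Digraph n) → IsOriented D → (m : ℕ) → IsFas D m →
  InvEqLe (h + h) D (divℕ m (h * h) ℚ.+ ℕ/1 (12 * ex))
invEqLe-greedy {n} k ex 3k≤n find D oriented m ((Fas , (Fas⊆D , acyclic) , refl) , _)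
  with r , r-injective , r-< ← topological-rank (delete Fas D) acyclic
  with s , t , s<t , t< ← two-least r r-injective (≤-trans (s≤s (s≤s z≤n)) 3k≤n)
  with l , (xss , pxss , xss≤ , c , xss≗) , l≤ ←
    reversal-greedy k ex {s} {t} 3k≤n (λ { refl → <-irrefl refl s<t }) find
      (size (backward D oriented r r-injective)) (backward D oriented r r-injective)
      (backward-irreflexive D oriented r r-injective) ≤-refl
  = map ⟪_⟫ xss ,
    All.map⁺ (All.map (λ (uniq , len) → trans (∣⟪⟫∣ uniq) len) pxss) ,
    reversal-acyclic D oriented r r-injective s<t t< (invertAll (map ⟪_⟫ xss) D) c irreflexive
      (λ u v u≢v → trans (invertAll-parity xss D u v) (cong (if_then D v u else D u v) (xss≗ u v u≢v))) ,
    -- Here k + k * h is the predecessor of the denominator h * h.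
    ℕ/1≤divℕ+ℕ/1 (length (map ⟪_⟫ xss)) (size Fas) (k + k * h) (12 * ex)
      (≤-trans (*-monoʳ-≤ (h * h) (≤-trans (≤-reflexive (length-map ⟪_⟫ xss)) xss≤))
        (≤-trans l≤ (+-monoˡ-≤ (h * h * (12 * ex)) (∑-mono-≤ (allFin n) λ u → ∑-mono-≤ (allFin n) λ v → bit-mono (backward⊆Fas u v)))))
  where
  h = suc k

  irreflexive : ∀ u → ¬ T (invertAll (map ⟪_⟫ xss) D u u)
  irreflexive u e = proj₁ oriented u (subst T (trans (invertAll-parity xss D u u) (if-eta (parity xss u u))) e)

  backward⊆Fas : ∀ u v → T (backward D oriented r r-injective u v) → T (Fas u v)
  backward⊆Fas u v t with Fas u v in Fas≡ | Equivalence.to T-∧ t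
  ... | true  | _          = _
  -- A backward arc outside `Fas` survives the deletion and hence ascends in r, a contradiction.
  ... | false | Duv , v<ᵇu = contradiction
    (r-< u v (Equivalence.from T-∧ (Duv , subst (T ∘ not) (sym Fas≡) _))) (<⇒≯ (<ᵇ⇒< _ _ v<ᵇu))

  bit-mono : ∀ {b c} → (T b → T c) → bit b ≤ bit c
  bit-mono {false}        _   = z≤n
  bit-mono {true} {true}  _   = ≤-refl
  bit-mono {true} {false} b⇒c = ⊥-elim (b⇒c _)

theorem4p13 : (p : ℕ) → 2 ≤ p → 2 ∣ p →
    Σ (ℕ → ℚ) λ g → LittleOSq g ×
    ∃ λ n₀ → ∀ (n : ℕ) → n₀ ≤ n → ∀ (D : Digraph n) → IsOriented D →
    ∀ (m : ℕ) → IsFas D m →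
    InvEqLe p D (divℕ m (⌈ p /2⌉ * ⌊ p /2⌋) ℚ.+ g n)
theorem4p13 _ () (divides zero refl)
theorem4p13 _ _ (divides (suc k) p≡)
  with refl ← trans p≡ (trans (*-comm (suc k) 2) (cong (suc k +_) (+-identityʳ (suc k)))) =
  ℕ/1 ∘ g , littleOSq g (error-littleO (h + h)) ,
  -- Room for the three vertices and the three padding blocks of size k in `realised-path`.
  3 + (k + (k + k)) ,
  λ n n₀≤n D oriented m fas →
    subst₂ (λ x y → InvEqLe (h + h) D (divℕ m (x * y) ℚ.+ ℕ/1 (g n))) ceil (n≡⌊n+n/2⌋ h)
      (invEqLe-greedy k (sparse (h + h) n) n₀≤n (biclique-or-size≤ (h + h) (≤-trans (s≤s z≤n) n₀≤n)) D oriented m fas)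
  where
  h = suc k
  g : ℕ → ℕ
  g = error (h + h)
  ceil : h ≡ ⌈ h + h /2⌉
  ceil = +-cancelˡ-≡ h _ _ (sym (trans (cong (_+ ⌈ h + h /2⌉) (n≡⌊n+n/2⌋ h)) (⌊n/2⌋+⌈n/2⌉≡n (h + h))))
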